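{- Let $\Sigma$ be a finite non-empty alphabet and let $k,\ell\in\mathbb N$. Then $\overset{J}{\sim}_{k,\ell}$ is an equivalence relation on $\Sigma^*$ of finite index (i.e. with finitely many equivalence classes).
   Context: $\mathbb N=\{1,2,\dots\}$, $\mathbb N_0=\mathbb N\cup\{0\}$. For a word $w\in\Sigma^*$, $|w|$ is its length, $|w|_a$ the number of occurrences of the letter $a$ in $w$, and $p(w)=(|w|_a)_{a\in\Sigma}$ its Parikh vector; $p(u)\le p(w)$ is meant componentwise. $\mathrm{ScatFact}(w)$ is the set of (not necessarily contiguous) subsequences of $w$. For $S\subseteq\Sigma^*$, $S_k=S\cap\Sigma^k$ and $S_{\le k}=\bigcup_{i=0}^k S_i$. For $\ell\in\mathbb N_0$, $\mathrm{JScatFact}(w,\ell)$ is the set of words $u\in\Sigma^*$ with $0\le\ell\le|u|-1$ (with only $\ell=0$ allowed if $u$ is empty), $p(u)\le p(w)$, and such that there is $v\in\mathrm{ScatFact}_{|u|-\ell}(u)$ with $v\in\mathrm{ScatFact}(w)$. For $v,w\in\Sigma^*$, $v\overset{J}{\sim}_{k,\ell}w$ means $\mathrm{JScatFact}_{\le k}(v,\ell)=\mathrm{JScatFact}_{\le k}(w,\ell)$. -}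

module Defs where

open import Data.Fin.Base using (Fin; toℕ)
open import Data.Fin.Properties using (inj⇒≟)
open import Data.List.Base using (List; filter; length)
open import Data.List.Relation.Binary.Sublist.Propositional using (_⊆_)
open import Data.List.Relation.Unary.Enumerates.Setoid using (IsEnumeration)
open import Data.Nat.Base using (ℕ; suc; _∸_; _≤_)
open import Data.Product.Base using (Σ-syntax; ∃-syntax; _×_)
open import Function.Bundles using (_↔_)
open import Function.Properties.Inverse using (↔⇒↣)
open import Level using (Level; _⊔_)
open import Relation.Binary.Bundles using (Setoid)
open import Relation.Binary.Core using (Rel)
open import Relation.Binary.Definitions using (DecidableEquality)
open import Relation.Binary.PropositionalEquality.Core using (_≡_)
open import Relation.Binary.Structures using (IsEquivalence)
open import Relation.Unary using (Pred; _∈_; _∩_; ⋃; _≐_)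

module _ {a ℓ : Level} {A : Set a} where

  -- The classes are finitely many: some finite list of elements of A meets
  -- every class.
  IsEquivalenceOfFiniteIndex : Rel A ℓ → Set (a ⊔ ℓ)
  IsEquivalenceOfFiniteIndex _≈_ =
    Σ[ isEquivalence ∈ IsEquivalence _≈_ ]
    ∃[ representatives ]
      IsEnumeration (record { isEquivalence = isEquivalence }) representatives

module _ {a p : Level} {A : Set a} where

  -- S ⟨ k ⟩ is S_k and S ⟨≤ k ⟩ is S_{≤k}.
  _⟨_⟩ : Pred (List A) p → ℕ → Pred (List A) p
  S ⟨ k ⟩ = S ∩ (λ w → length w ≡ k)

  _⟨≤_⟩ : Pred (List A) p → ℕ → Pred (List A) p
  S ⟨≤ k ⟩ = ⋃[ i ∶ Fin (suc k) ] (S ⟨ toℕ i ⟩)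

ScatFact : {a : Level} {A : Set a} → List A → Pred (List A) a
ScatFact w u = u ⊆ w

module Words {a : Level} {A : Set a} {n : ℕ} (A↔Fin : A ↔ Fin n) where

  _≟_ : DecidableEquality A
  _≟_ = inj⇒≟ (↔⇒↣ A↔Fin)

  parikh : List A → A → ℕ
  parikh w x = length (filter (x ≟_) w)

  _≤ᵖ_ : Rel (A → ℕ) a
  f ≤ᵖ g = ∀ x → f x ≤ g x

  -- Since 0 ∸ 1 = 0, the first condition forces ℓ = 0 when u is empty.
  JScatFact : List A → ℕ → Pred (List A) a
  JScatFact w ℓ u =
      ℓ ≤ length u ∸ 1
    × parikh u ≤ᵖ parikh w
    × ∃[ v ] (v ∈ ScatFact u ⟨ length u ∸ ℓ ⟩ × v ∈ ScatFact w)

  J∼ : ℕ → ℕ → Rel (List A) a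
  J∼ k ℓ v w = JScatFact v ℓ ⟨≤ k ⟩ ≐ JScatFact w ℓ ⟨≤ k ⟩

{-# OPTIONS --safe #-}

-- Every word w has a scattered factor t which contains all scattered factors
-- of w of length at most k, and whose length is bounded in terms of k and the
-- alphabet: take the union of one embedding into w per such factor. For
-- |u| ≤ k, whether u is in JScatFact(w, ℓ) depends only on these scattered
-- factors, the Parikh condition because it says that w contains the powers
-- x^|u|_x. So t ∼ w, and the words up to the length bound represent all classes.

module Submission where

open import Defs
open import Data.Fin.Base using (Fin)
open import Data.Fin.Properties using (toℕ≤pred[n])
open import Data.List.Base
  using (List; []; _∷_; [_]; length; filter; map; allFin; cartesianProductWith)
open import Data.List.Membership.Propositional using () renaming (_∈_ to _∈ₗ_)
open import Data.List.Membership.Propositional.Properties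
  using (∈-map⁺; ∈-allFin; ∈-cartesianProductWith⁺)
open import Data.List.Properties using (filter-idem)
open import Data.List.Relation.Binary.Sublist.DecPropositional using () renaming (_⊆?_ to sublist?)
open import Data.List.Relation.Binary.Sublist.Propositional
  using (_⊆_; []; _∷_; _∷ʳ_; minimum; ⊆-trans)
open import Data.List.Relation.Binary.Sublist.Propositional.Properties
  using (filter⁺; filter-⊆; length-mono-≤)
open import Data.List.Relation.Unary.All as All using (All; []; _∷_)
open import Data.List.Relation.Unary.All.Properties using (all-filter)
open import Data.List.Relation.Unary.Any as Any using (here; there)
open import Data.Nat.Base using (ℕ; zero; suc; _+_; _≤_; z≤n; s≤s; s≤s⁻¹; NonZero)
open import Data.Nat.ListAction using (sum)
open import Data.Nat.Properties
  using (≤-refl; ≤-trans; ≤-reflexive; m≤n⇒m≤1+n; +-suc; +-monoʳ-≤; m≤n+m)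
open import Data.Product.Base using (∃-syntax; _×_; _,_)
open import Function.Bundles using (_↔_; Inverse)
open import Level using (Level)
import Relation.Binary.Construct.On as On
open import Relation.Binary.Definitions using (DecidableEquality)
open import Relation.Binary.PropositionalEquality.Core using (_≡_; refl; sym; subst)
open import Relation.Binary.Structures using (IsEquivalence)
open import Relation.Nullary.Decidable.Core using (yes; no)
open import Relation.Nullary.Negation.Core using (contradiction)
open import Relation.Unary.Relation.Binary.Equality using (≐-isEquivalence)

private
  variable
    a : Level
    A : Set a
    x : A
    xs ys zs : List A

-- Walk along `zs` and keep each position that at least one of the two embeddings uses. A position
-- used by both is kept only once, so the lengths give an inequality.
⊆-union : xs ⊆ zs → ys ⊆ zs →
          ∃[ us ] (xs ⊆ us × ys ⊆ us × us ⊆ zs × length us ≤ length xs + length ys)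
⊆-union [] [] = [] , [] , [] , [] , z≤n
⊆-union (z ∷ʳ p) (.z ∷ʳ q) with ⊆-union p q
... | us , i , j , s , b = us , i , j , z ∷ʳ s , b
⊆-union (refl ∷ p) (z ∷ʳ q) with ⊆-union p q
... | us , i , j , s , b = z ∷ us , refl ∷ i , z ∷ʳ j , refl ∷ s , s≤s b
⊆-union (z ∷ʳ p) (refl ∷ q) with ⊆-union p q
... | us , i , j , s , b =
  z ∷ us , z ∷ʳ i , refl ∷ j , refl ∷ s , ≤-trans (s≤s b) (≤-reflexive (sym (+-suc _ _)))
⊆-union {xs = _ ∷ xs} (refl ∷ p) (refl ∷ q) with ⊆-union p q
... | us , i , j , s , b =
  _ ∷ us , refl ∷ i , refl ∷ j , refl ∷ s ,
  s≤s (≤-trans b (+-monoʳ-≤ (length xs) (m≤n⇒m≤1+n ≤-refl)))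

-- The union grows by one embedding for each `v` that occurs in `w`. The length bound sums over all
-- of `vs`, including words that do not embed in `w`, so that it is independent of `w`.
⊆-compress : DecidableEquality A → (vs : List (List A)) (w : List A) →
             ∃[ t ] (t ⊆ w × length t ≤ sum (map length vs) × All (λ v → v ⊆ w → v ⊆ t) vs)
⊆-compress _≟_ [] w = [] , minimum w , z≤n , []
⊆-compress _≟_ (v ∷ vs) w with ⊆-compress _≟_ vs w | sublist? _≟_ v w
... | t , t⊆w , t≤ , vs⊆t | no v⊈w =
  t , t⊆w , ≤-trans t≤ (m≤n+m _ (length v)) , (λ v⊆w → contradiction v⊆w v⊈w) ∷ vs⊆t
... | t , t⊆w , t≤ , vs⊆t | yes v⊆w with ⊆-union v⊆w t⊆w
...   | us , v⊆us , t⊆us , us⊆w , us≤ =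
  us , us⊆w , ≤-trans us≤ (+-monoʳ-≤ (length v) t≤) ,
  (λ _ → v⊆us) ∷ All.map (λ v⊆t v⊆w → ⊆-trans (v⊆t v⊆w) t⊆us) vs⊆t

constant-⊆ : All (x ≡_) xs → All (x ≡_) ys → length xs ≤ length ys → xs ⊆ ys
constant-⊆ []          _           _       = minimum _
constant-⊆ (refl ∷ ps) (refl ∷ qs) (s≤s b) = refl ∷ constant-⊆ ps qs b

words≤ : List A → ℕ → List (List A)
words≤ letters zero    = [ [] ]
words≤ letters (suc m) = [] ∷ cartesianProductWith _∷_ letters (words≤ letters m)

∈-words≤ : {letters : List A} → (∀ x → x ∈ₗ letters) →
           (m : ℕ) (w : List A) → length w ≤ m → w ∈ₗ words≤ letters m
∈-words≤ _∈letters zero    []      _ = here refl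
∈-words≤ _∈letters (suc m) []      _ = here refl
∈-words≤ _∈letters (suc m) (x ∷ w) b =
  there (∈-cartesianProductWith⁺ _∷_ (x ∈letters) (∈-words≤ _∈letters m w (s≤s⁻¹ b)))

module _ {n : ℕ} (A↔Fin : A ↔ Fin n) where
  open Words A↔Fin

  private
    open Inverse A↔Fin using (from; to; strictlyInverseʳ)

    letters : List A
    letters = map from (allFin n)

    _∈letters : ∀ x → x ∈ₗ letters
    x ∈letters = subst (_∈ₗ letters) (strictlyInverseʳ x) (∈-map⁺ from (∈-allFin (to x)))

  J∼-isEquivalence : ∀ k ℓ → IsEquivalence (J∼ k ℓ)
  J∼-isEquivalence k ℓ = On.isEquivalence (λ w → JScatFact w ℓ ⟨≤ k ⟩) ≐-isEquivalence

  parikh-mono : xs ⊆ ys → parikh xs ≤ᵖ parikh ys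
  parikh-mono xs⊆ys x = length-mono-≤ (filter⁺ (x ≟_) (x ≟_) (λ { refl p → p }) xs⊆ys)

  -- `filter (x ≟_) u` is a power of `x`. It embeds in the power of `x` formed by all occurrences of
  -- `x` in `w`, which is itself a scattered factor of `w`.
  filter-⊆-of-parikh : ∀ u w x → parikh u x ≤ parikh w x → filter (x ≟_) u ⊆ w
  filter-⊆-of-parikh u w x b =
    ⊆-trans (constant-⊆ (all-filter (x ≟_) u) (all-filter (x ≟_) w) b) (filter-⊆ (x ≟_) w)

  parikh-of-filter-⊆ : ∀ u w x → filter (x ≟_) u ⊆ w → parikh u x ≤ parikh w x
  parikh-of-filter-⊆ u w x p =
    -- Idempotence of the filter says that the power of `x` extracted from `u` contains as many `x`
    -- as `u` does.
    subst (λ v → length v ≤ parikh w x) (filter-idem (x ≟_) u) (parikh-mono p x)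

  -- Only the Parikh condition and the witness `v` refer to the ambient word. Both transfer through
  -- scattered factors of `u`, hence through words no longer than `u`: the powers of single letters,
  -- and `v` itself.
  JScatFact-mono : ∀ {t w u ℓ} → (∀ v → length v ≤ length u → v ⊆ t → v ⊆ w) →
                   JScatFact t ℓ u → JScatFact w ℓ u
  JScatFact-mono {t} {w} {u} t⇒w (ℓ≤ , p , v , (v⊆u , |v|) , v⊆t) =
    ℓ≤ ,
    (λ x → parikh-of-filter-⊆ u w x
             (t⇒w _ (length-mono-≤ (filter-⊆ (x ≟_) u)) (filter-⊆-of-parikh u t x (p x)))) ,
    v , (v⊆u , |v|) , t⇒w v (length-mono-≤ v⊆u) v⊆t

  J∼-of-⊆ : ∀ {v w} k ℓ → v ⊆ w → (∀ u → length u ≤ k → u ⊆ w → u ⊆ v) → J∼ k ℓ w v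
  J∼-of-⊆ k ℓ v⊆w w⇒v =
    (λ (i , j , |u|) → i ,
       JScatFact-mono
         -- Since `i` lies in `Fin (suc k)`, the length of `u` is at most `k`, and so is that of
         -- `v`.
         (λ v b → w⇒v v (≤-trans b (≤-trans (≤-reflexive |u|) (toℕ≤pred[n] i)))) j ,
       |u|) ,
    (λ (i , j , |u|) → i , JScatFact-mono (λ _ _ u⊆v → ⊆-trans u⊆v v⊆w) j , |u|)

  J∼-isEquivalenceOfFiniteIndex : ∀ k ℓ → IsEquivalenceOfFiniteIndex (J∼ k ℓ)
  J∼-isEquivalenceOfFiniteIndex k ℓ =
    J∼-isEquivalence k ℓ , words≤ letters bound , enumerates
    where
    factors = words≤ letters k
    -- Fixed before any `w` is given, so one list of representatives serves all words.
    bound   = sum (map length factors)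

    enumerates : ∀ w → Any.Any (J∼ k ℓ w) (words≤ letters bound)
    enumerates w with ⊆-compress _≟_ factors w
    ... | t , t⊆w , t≤ , w⇒t =
      -- The representative of the class of `w` is the compressed word `t` itself, which is short
      -- enough to be listed.
      Any.map (λ { refl → J∼-of-⊆ k ℓ t⊆w
                            (λ u b → All.lookup w⇒t (∈-words≤ _∈letters k u b)) })
              (∈-words≤ _∈letters bound t t≤)

lemma23 : {a : Level} {A : Set a} {n : ℕ} .{{_ : NonZero n}} (A↔Fin : A ↔ Fin n) →
    (k ℓ : ℕ) .{{_ : NonZero k}} .{{_ : NonZero ℓ}} →
    IsEquivalenceOfFiniteIndex (Words.J∼ A↔Fin k ℓ)
lemma23 A↔Fin k ℓ = J∼-isEquivalenceOfFiniteIndex A↔Fin k ℓ
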